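{- For every integer $n\ge 0$ and all integers $r,k\in\mathbb{Z}$, $$\sum_{m=0}^{n}\binom{n+1}{m}(-1)^{n-m}s_{m}^{(r,k)}=\sum_{l=0}^{n}\sum_{m=0}^{l}(-1)^{l-m}\binom{l}{m}\binom{n+1}{l+1}B_{m}^{(k-1)}\,\mathbb{B}_{n-l}^{(r)}.$$
   Context: For $k\in\mathbb{Z}$, $Li_k(x)=\sum_{n=1}^{\infty}\frac{x^n}{n^k}$ is the polylogarithm, regarded as a formal power series; $\frac{Li_k(1-e^{ -t})}{1-e^{ -t}}$ is then a formal power series in $t$ over $\mathbb{C}$. For $k\in\mathbb{Z}$, the poly-Bernoulli numbers $B_n^{(k)}$ are defined by $\frac{Li_k(1-e^{ -t})}{1-e^{ -t}}=\sum_{n\ge0}B_n^{(k)}\frac{t^n}{n!}$. For $r\in\mathbb{Z}$, the Bernoulli numbers of order $r$, $\mathbb{B}_n^{(r)}$, are defined by $\left(\frac{t}{e^t-1}\right)^r=\sum_{n\ge0}\mathbb{B}_n^{(r)}\frac{t^n}{n!}$. (The symbols $B_n^{(k)}$ and $\mathbb{B}_n^{(r)}$ denote different sequences.) For $r,k\in\mathbb{Z}$, the higher-order Bernoulli and poly-Bernoulli mixed type numbers $s_n^{(r,k)}$ are defined by $\left(\frac{t}{e^t-1}\right)^r\frac{Li_k(1-e^{ -t})}{1-e^{ -t}}=\sum_{n\ge0}s_n^{(r,k)}\frac{t^n}{n!}$. -}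

module Defs where

open import Algebra.Bundles using (CommutativeRing)
open import Data.Fin.Base using (toℕ)
open import Data.Integer.Base as ℤ using (ℤ; +_; -[1+_])
open import Data.Nat.Base as ℕ using (ℕ; zero; suc; _∸_; _!)
open import Data.Nat.Combinatorics using (_C_)
open import Data.Nat.Properties using (_!≢0; m^n≢0)
open import Data.Rational.Base
  using (ℚ; 0ℚ; 1ℚ; _+_; _*_; _-_; -_; _/_; 1/_; NonZero; +-*-rawSemiring)
open import Data.Rational.Properties using (+-*-commutativeRing)

open import Algebra.Definitions.RawSemiring +-*-rawSemiring public using (_^_)
open import Algebra.Properties.Semiring.Sum
  (CommutativeRing.semiring +-*-commutativeRing) public
  using (sum-syntax; sum⁺-syntax)

fromℕ : ℕ → ℚ
fromℕ n = + n / 1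

binom : ℕ → ℕ → ℚ
binom n m = fromℕ (n C m)

sgn : ℕ → ℚ
sgn n = (- 1ℚ) ^ n

-- A formal power series is its coefficient sequence.  Rational coefficients
-- suffice: every series below is defined over ℚ.
FPS : Set
FPS = ℕ → ℚ

infixl 7 _⊛_ _⊘_
infixl 6 _⊖_
infixr 8 _^ˢ_ _^ᶻ_
infixr 9 _∘ˢ_
infix  9 _⁻¹

1ˢ : FPS
1ˢ zero    = 1ℚ
1ˢ (suc _) = 0ℚ

_⊖_ : FPS → FPS → FPS
(f ⊖ g) n = f n - g n

_⊛_ : FPS → FPS → FPS
(f ⊛ g) n = ∑[ i ≤ n ] (f (toℕ i) * g (n ∸ toℕ i))

_^ˢ_ : FPS → ℕ → FPS
f ^ˢ zero  = 1ˢ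
f ^ˢ suc j = f ⊛ f ^ˢ j

-- The composite f(g(t)), for g with zero constant term: g ^ˢ j then starts in
-- degree j, so the terms with j > n do not contribute to the coefficient of tⁿ.
_∘ˢ_ : FPS → FPS → FPS
(f ∘ˢ g) n = ∑[ j ≤ n ] (f (toℕ j) * (g ^ˢ toℕ j) n)

-- With c = f 0, the inverse is c⁻¹ ∑ⱼ (1 - c⁻¹ f)ʲ.
_⁻¹ : (f : FPS) → .{{NonZero (f 0)}} → FPS
(f ⁻¹) n = 1/ f 0 * ((λ _ → 1ℚ) ∘ˢ (λ m → 1ˢ m - 1/ f 0 * f m)) n

_^ᶻ_ : (f : FPS) → ℤ → .{{NonZero (f 0)}} → FPS
f ^ᶻ (+ n)    = f ^ˢ n
f ^ᶻ -[1+ n ] = (f ⁻¹) ^ˢ suc n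

-- f(t)/t, for f with zero constant term.
_/t : FPS → FPS
(f /t) n = f (suc n)

-- The quotient f/g, for f and g with zero constant term and g with nonzero
-- linear term: cancel t, then multiply by the inverse.
_⊘_ : (f g : FPS) → .{{NonZero (g 1)}} → FPS
f ⊘ g = (f /t) ⊛ (g /t) ⁻¹

tˢ : FPS
tˢ 1 = 1ℚ
tˢ _ = 0ℚ

exp : FPS
exp n = (+ 1 / (n !)) {{n !≢0}}

exp⁻ : FPS
exp⁻ n = sgn n * exp n

Li : ℤ → FPS
Li k        zero    = 0ℚ
Li (+ m)    (suc n) = (+ 1 / (suc n ℕ.^ m)) {{m^n≢0 (suc n) m}}
Li -[1+ m ] (suc n) = fromℕ (suc n ℕ.^ suc m)

-- The sequence (aₙ) with f = ∑ aₙ tⁿ/n!.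
egf-coeff : FPS → ℕ → ℚ
egf-coeff f n = fromℕ (n !) * f n

bernoulliSeries : ℤ → FPS
bernoulliSeries r = (tˢ ⊘ (exp ⊖ 1ˢ)) ^ᶻ r

polyBernoulliSeries : ℤ → FPS
polyBernoulliSeries k = (Li k ∘ˢ (1ˢ ⊖ exp⁻)) ⊘ (1ˢ ⊖ exp⁻)

polyBernoulli : ℤ → ℕ → ℚ
polyBernoulli k = egf-coeff (polyBernoulliSeries k)

bernoulli : ℤ → ℕ → ℚ
bernoulli r = egf-coeff (bernoulliSeries r)

mixed : ℤ → ℤ → ℕ → ℚ
mixed r k = egf-coeff (bernoulliSeries r ⊛ polyBernoulliSeries k)

{-# OPTIONS --safe #-}

-- Put g = 1 - e⁻ᵗ, L = Li k ∘ g and F = (t/(eᵗ - 1))ʳ.  Both sides are (n+1)!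
-- times the coefficient of tⁿ⁺¹ in F ⊛ L.  The left-hand side reads it off from
-- F ⊛ L = (F ⊛ L/g) ⊛ (1 - e⁻ᵗ), where L/g is the poly-Bernoulli series of index k.
-- The right-hand side multiplies F by L directly: by the chain rule and
-- x (Li k)′ = Li (k - 1), L′ = (Li (k - 1) ∘ g)/g · e⁻ᵗ, which gives the coefficients
-- of L in terms of the poly-Bernoulli numbers of index k - 1.
module Submission where

open import Defs
open import Algebra.Bundles using (CommutativeRing)
open import Data.Fin.Base using (toℕ; zero; suc)
open import Data.Fin.Properties using (toℕ<n)
open import Data.Integer.Base as ℤ using (ℤ; 1ℤ; _-_; -[1+_])
import Data.Integer.Properties as ℤ
open import Data.Nat.Base as ℕ using (ℕ; zero; suc; _∸_; _!; z≤n; s≤s; _≤_; _<_)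
open import Data.Nat.Combinatorics using (_C_; k![n∸k]!∣n!)
open import Data.Nat.Combinatorics.Specification using (nCk≡n!/k![n-k]!)
open import Data.Nat.DivMod using (m/n*n≡m)
import Data.Nat.Properties as ℕ
open import Data.Rational.Base as ℚ
  using (ℚ; 0ℚ; 1ℚ; _+_; _*_; _/_; -_; 1/_; fromℚᵘ; NonZero)
open import Data.Rational.Properties
  using ( +-*-commutativeRing; toℚᵘ-injective; toℚᵘ-fromℚᵘ; toℚᵘ-homo-+; toℚᵘ-homo-*
        ; fromℚᵘ-cong; +-identityˡ; +-identityʳ; *-comm; *-assoc; *-identityˡ; *-identityʳ
        ; *-zeroˡ; *-zeroʳ; *-inverseˡ; _≟_)
open import Data.Rational.Unnormalised.Base as ℚᵘ using (mkℚᵘ; *≡*)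
import Data.Rational.Unnormalised.Properties as ℚᵘ
open import Algebra.Properties.Semiring.Sum
  (CommutativeRing.semiring +-*-commutativeRing)
  using (sum-cong-≗; sum-replicate-zero; ∑-distrib-+; ∑-comm; *-distribˡ-sum; *-distribʳ-sum)
open import Relation.Binary.PropositionalEquality
  using (_≡_; _≗_; refl; sym; trans; cong; cong₂; module ≡-Reasoning)
open import Relation.Nullary.Decidable using (dec⇒maybe)
open import Tactic.RingSolver using (solve-∀)
open import Tactic.RingSolver.Core.AlmostCommutativeRing
  using (AlmostCommutativeRing; fromCommutativeRing)

open ≡-Reasoning

private
  ring : AlmostCommutativeRing _ _
  ring = fromCommutativeRing +-*-commutativeRing (λ x → dec⇒maybe (0ℚ ≟ x))

-- Rational arithmetic of naturals, factorials and binomial coefficients.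

*-swap : ∀ a b c → a * (b * c) ≡ b * (a * c)
*-swap = solve-∀ ring

*-shift : ∀ a b c → a * (b * c) ≡ b * a * c
*-shift = solve-∀ ring

-- Up to `≃`, `toℚᵘ` is an injective homomorphism undoing `fromℚᵘ`, so the equation can be checked
-- on unnormalised fractions. Both `fromℕ n` and the reciprocals `+ 1 / n` are values of `fromℚᵘ`.
fromℚᵘ-homo-+ : ∀ p q → fromℚᵘ p + fromℚᵘ q ≡ fromℚᵘ (p ℚᵘ.+ q)
fromℚᵘ-homo-+ p q = toℚᵘ-injective
  (ℚᵘ.≃-trans (toℚᵘ-homo-+ (fromℚᵘ p) (fromℚᵘ q))
  (ℚᵘ.≃-trans (ℚᵘ.+-cong (toℚᵘ-fromℚᵘ p) (toℚᵘ-fromℚᵘ q))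
              (ℚᵘ.≃-sym (toℚᵘ-fromℚᵘ (p ℚᵘ.+ q)))))

fromℚᵘ-homo-* : ∀ p q → fromℚᵘ p * fromℚᵘ q ≡ fromℚᵘ (p ℚᵘ.* q)
fromℚᵘ-homo-* p q = toℚᵘ-injective
  (ℚᵘ.≃-trans (toℚᵘ-homo-* (fromℚᵘ p) (fromℚᵘ q))
  (ℚᵘ.≃-trans (ℚᵘ.*-cong (toℚᵘ-fromℚᵘ p) (toℚᵘ-fromℚᵘ q))
              (ℚᵘ.≃-sym (toℚᵘ-fromℚᵘ (p ℚᵘ.* q)))))

fromℕ-suc : ∀ n → fromℕ (suc n) ≡ 1ℚ + fromℕ n
fromℕ-suc n = sym (trans (fromℚᵘ-homo-+ (mkℚᵘ 1ℤ 0) (mkℚᵘ (ℤ.+ n) 0))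
  (fromℚᵘ-cong {mkℚᵘ 1ℤ 0 ℚᵘ.+ mkℚᵘ (ℤ.+ n) 0} {mkℚᵘ (ℤ.+ suc n) 0}
    (*≡* (cong (ℤ._* 1ℤ) (cong (ℤ._+_ 1ℤ) (ℤ.*-identityʳ (ℤ.+ n)))))))

fromℕ-* : ∀ m n → fromℕ (m ℕ.* n) ≡ fromℕ m * fromℕ n
fromℕ-* m n = sym (trans (fromℚᵘ-homo-* (mkℚᵘ (ℤ.+ m) 0) (mkℚᵘ (ℤ.+ n) 0))
  (fromℚᵘ-cong {mkℚᵘ (ℤ.+ m) 0 ℚᵘ.* mkℚᵘ (ℤ.+ n) 0} {mkℚᵘ (ℤ.+ (m ℕ.* n)) 0}
    (*≡* (cong (ℤ._* 1ℤ) (sym (ℤ.pos-* m n))))))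

fromℕ-inverseʳ : ∀ n .{{_ : ℕ.NonZero n}} → fromℕ n * (ℤ.+ 1 / n) ≡ 1ℚ
fromℕ-inverseʳ (suc n) = trans (fromℚᵘ-homo-* (mkℚᵘ (ℤ.+ suc n) 0) (mkℚᵘ (ℤ.+ 1) n))
  (fromℚᵘ-cong (ℚᵘ.*-inverseʳ (mkℚᵘ (ℤ.+ suc n) 0)))

inverse-unique : ∀ {a b c} → a * b ≡ 1ℚ → a * c ≡ 1ℚ → b ≡ c
inverse-unique {a} {b} {c} ab ac = begin
  b           ≡⟨ *-identityʳ b ⟨
  b * 1ℚ      ≡⟨ cong (b *_) ac ⟨
  b * (a * c) ≡⟨ *-shift b a c ⟩
  a * b * c   ≡⟨ cong (_* c) ab ⟩
  1ℚ * c      ≡⟨ *-identityˡ c ⟩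
  c           ∎

!-exp : ∀ n → fromℕ (n !) * exp n ≡ 1ℚ
!-exp n = fromℕ-inverseʳ (n !) {{n ℕ.!≢0}}

-- Both sides are inverse to `n !`. This is the coefficient form of the fact that `exp` is its own
-- derivative.
suc-exp : ∀ n → fromℕ (suc n) * exp (suc n) ≡ exp n
suc-exp n = inverse-unique {fromℕ (n !)} lemma (!-exp n)
  where
  lemma : fromℕ (n !) * (fromℕ (suc n) * exp (suc n)) ≡ 1ℚ
  lemma = trans (*-shift (fromℕ (n !)) (fromℕ (suc n)) (exp (suc n)))
    (trans (cong (_* exp (suc n)) (sym (fromℕ-* (suc n) (n !)))) (!-exp (suc n)))

-- The factorial formula for binomials, with `exp (n ∸ m)` standing for the reciprocal of
-- `(n ∸ m) !`. It is what turns binomial sums of egf coefficients into Cauchy products.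
binom-! : ∀ {n m} → m ≤ n → binom n m * fromℕ (m !) ≡ fromℕ (n !) * exp (n ∸ m)
binom-! {n} {m} m≤n = begin
  B * M             ≡⟨ *-identityʳ (B * M) ⟨
  B * M * 1ℚ        ≡⟨ cong ((B * M) *_) (!-exp (n ∸ m)) ⟨
  B * M * (D * E)   ≡⟨ shuffle B M D E ⟩
  B * (M * D) * E   ≡⟨ cong (_* E) (cong (B *_) (fromℕ-* (m !) ((n ∸ m) !))) ⟨
  B * fromℕ (m ! ℕ.* (n ∸ m) !) * E ≡⟨ cong (_* E) (fromℕ-* (n C m) (m ! ℕ.* (n ∸ m) !)) ⟨
  fromℕ ((n C m) ℕ.* (m ! ℕ.* (n ∸ m) !)) * E ≡⟨ cong (λ x → fromℕ x * E) C-! ⟩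
  fromℕ (n !) * E   ∎
  where
  B = binom n m
  M = fromℕ (m !)
  D = fromℕ ((n ∸ m) !)
  E = exp (n ∸ m)
  instance _ = m ℕ.!* (n ∸ m) !≢0
  C-! : (n C m) ℕ.* (m ! ℕ.* (n ∸ m) !) ≡ n !
  C-! = trans (cong (ℕ._* (m ! ℕ.* (n ∸ m) !)) (nCk≡n!/k![n-k]! m≤n))
    (m/n*n≡m (k![n∸k]!∣n! m≤n))
  shuffle : ∀ b m d e → b * m * (d * e) ≡ b * (m * d) * e
  shuffle = solve-∀ ring

-- The algebra of formal power series: linear structure, Cauchy product, derivation `D`.

infixl 6 _⊕_
infixl 7 _•_

_⊕_ : FPS → FPS → FPS
(f ⊕ g) n = f n + g n

_•_ : ℚ → FPS → FPS
(c • f) n = c * f n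

D : FPS → FPS
D f n = fromℕ (suc n) * f (suc n)

⊛-cong : ∀ {f f′ g g′} → f ≗ f′ → g ≗ g′ → f ⊛ g ≗ f′ ⊛ g′
⊛-cong p q n = sum-cong-≗ {suc n} (λ i → cong₂ _*_ (p (toℕ i)) (q (n ∸ toℕ i)))

⊛-congˡ : ∀ f {g g′} → g ≗ g′ → f ⊛ g ≗ f ⊛ g′
⊛-congˡ f = ⊛-cong {f} (λ _ → refl)

⊛-congʳ : ∀ {f f′} g → f ≗ f′ → f ⊛ g ≗ f′ ⊛ g
⊛-congʳ g p = ⊛-cong {g = g} p (λ _ → refl)

-- The mirror image, (f ⊛ g) (suc n) = f 0 * g (suc n) + (f /t ⊛ g) n, holds definitionally.
⊛-shiftʳ : ∀ f g n → (f ⊛ g) (suc n) ≡ f (suc n) * g 0 + (f ⊛ g /t) n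
⊛-shiftʳ f g zero = swap (f 0 * g 1) (f 1 * g 0)
  where
  swap : ∀ a b → a + (b + 0ℚ) ≡ b + (a + 0ℚ)
  swap = solve-∀ ring
⊛-shiftʳ f g (suc n) = trans (cong ((f 0 * g (suc (suc n))) +_) (⊛-shiftʳ (f /t) g n))
  (swap (f 0 * g (suc (suc n))) (f (suc (suc n)) * g 0) ((f /t ⊛ g /t) n))
  where
  swap : ∀ a b c → a + (b + c) ≡ b + (a + c)
  swap = solve-∀ ring

⊛-comm : ∀ f g → f ⊛ g ≗ g ⊛ f
⊛-comm f g zero    = cong (_+ 0ℚ) (*-comm (f 0) (g 0))
⊛-comm f g (suc n) = begin
  f 0 * g (suc n) + (f /t ⊛ g) n ≡⟨ cong₂ _+_ (*-comm (f 0) (g (suc n))) (⊛-comm (f /t) g n) ⟩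
  g (suc n) * f 0 + (g ⊛ f /t) n ≡⟨ ⊛-shiftʳ g f n ⟨
  (g ⊛ f) (suc n)                ∎

⊛-distribʳ-⊕ : ∀ f g h → (f ⊕ g) ⊛ h ≗ f ⊛ h ⊕ g ⊛ h
⊛-distribʳ-⊕ f g h n = trans
  (sum-cong-≗ {suc n} (λ i → distrib (f (toℕ i)) (g (toℕ i)) (h (n ∸ toℕ i))))
  (∑-distrib-+ {suc n} (λ i → f (toℕ i) * h (n ∸ toℕ i)) (λ i → g (toℕ i) * h (n ∸ toℕ i)))
  where
  distrib : ∀ a b c → (a + b) * c ≡ a * c + b * c
  distrib = solve-∀ ring

⊛-•ˡ : ∀ c f g → (c • f) ⊛ g ≗ c • (f ⊛ g)
⊛-•ˡ c f g n = trans
  (sum-cong-≗ {suc n} (λ i → *-assoc c (f (toℕ i)) (g (n ∸ toℕ i))))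
  (sym (*-distribˡ-sum {suc n} c (λ i → f (toℕ i) * g (n ∸ toℕ i))))

⊛-•ʳ : ∀ c f g → f ⊛ (c • g) ≗ c • (f ⊛ g)
⊛-•ʳ c f g n = begin
  (f ⊛ (c • g)) n ≡⟨ ⊛-comm f (c • g) n ⟩
  ((c • g) ⊛ f) n ≡⟨ ⊛-•ˡ c g f n ⟩
  c * (g ⊛ f) n   ≡⟨ cong (c *_) (⊛-comm g f n) ⟩
  c * (f ⊛ g) n   ∎

⊛-assoc : ∀ f g h → (f ⊛ g) ⊛ h ≗ f ⊛ (g ⊛ h)
⊛-assoc f g h zero    = assoc₀ (f 0) (g 0) (h 0)
  where
  assoc₀ : ∀ a b c → (a * b + 0ℚ) * c + 0ℚ ≡ a * (b * c + 0ℚ) + 0ℚ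
  assoc₀ = solve-∀ ring
⊛-assoc f g h (suc n) = begin
  -- `(f ⊛ g) /t` unfolds to `f 0 • g /t ⊕ f /t ⊛ g`; linearity splits it, and the induction
  -- hypothesis applies to `f /t`.
  (f 0 * g 0 + 0ℚ) * h (suc n) + ((f 0 • g /t ⊕ f /t ⊛ g) ⊛ h) n
    ≡⟨ cong (((f 0 * g 0 + 0ℚ) * h (suc n)) +_) (⊛-distribʳ-⊕ (f 0 • g /t) (f /t ⊛ g) h n) ⟩
  (f 0 * g 0 + 0ℚ) * h (suc n) + (((f 0 • g /t) ⊛ h) n + ((f /t ⊛ g) ⊛ h) n)
    ≡⟨ cong (((f 0 * g 0 + 0ℚ) * h (suc n)) +_)
        (cong₂ _+_ (⊛-•ˡ (f 0) (g /t) h n) (⊛-assoc (f /t) g h n)) ⟩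
  (f 0 * g 0 + 0ℚ) * h (suc n) + (f 0 * (g /t ⊛ h) n + (f /t ⊛ (g ⊛ h)) n)
    ≡⟨ regroup (f 0) (g 0) (h (suc n)) ((g /t ⊛ h) n) ((f /t ⊛ (g ⊛ h)) n) ⟩
  f 0 * (g 0 * h (suc n) + (g /t ⊛ h) n) + (f /t ⊛ (g ⊛ h)) n ∎
  where
  regroup : ∀ a b c d e → (a * b + 0ℚ) * c + (a * d + e) ≡ a * (b * c + d) + e
  regroup = solve-∀ ring

⊛-zeroˡ : ∀ g → (λ _ → 0ℚ) ⊛ g ≗ (λ _ → 0ℚ)
⊛-zeroˡ g n = trans (sum-cong-≗ {suc n} (λ i → *-zeroˡ (g (n ∸ toℕ i)))) (sum-replicate-zero (suc n))

⊛-identityˡ : ∀ f → 1ˢ ⊛ f ≗ f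
⊛-identityˡ f zero    = trans (+-identityʳ (1ℚ * f 0)) (*-identityˡ (f 0))
⊛-identityˡ f (suc n) = begin
  1ℚ * f (suc n) + ((λ _ → 0ℚ) ⊛ f) n ≡⟨ cong₂ _+_ (*-identityˡ (f (suc n))) (⊛-zeroˡ f n) ⟩
  f (suc n) + 0ℚ                     ≡⟨ +-identityʳ (f (suc n)) ⟩
  f (suc n)                          ∎

-- From f = f 0 + t · (f /t) one gets f′ = f /t + t · (f /t)′; dropping the constant terms gives the
-- claim.
D-/t : ∀ f → D f /t ≗ f /t /t ⊕ D (f /t)
D-/t f n = trans (cong (_* f (suc (suc n))) (fromℕ-suc (suc n))) (expand (fromℕ (suc n)) (f (suc (suc n))))
  where
  expand : ∀ a b → (1ℚ + a) * b ≡ b + a * b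
  expand = solve-∀ ring

-- Induction on the degree, peeling the leading coefficient off `f`. Writing n + 2 = 1 + (n + 1),
-- the extra 1 yields a copy of `f /t ⊛ g`. It supplies the constant term of `D f` and the summand
-- `f /t /t` by which `D f /t` differs from `D (f /t)`.
D-leibniz : ∀ f g → D (f ⊛ g) ≗ D f ⊛ g ⊕ f ⊛ D g
D-leibniz f g zero = expand (f 0) (f 1) (g 0) (g 1)
  where
  expand : ∀ a b c d → 1ℚ * (a * d + (b * c + 0ℚ)) ≡ 1ℚ * b * c + 0ℚ + (a * (1ℚ * d) + 0ℚ)
  expand = solve-∀ ring
D-leibniz f g (suc n) = begin
  N₂ * (f 0 * g (suc (suc n)) + (f /t ⊛ g) (suc n))
    ≡⟨ cong (_* (f ⊛ g) (suc (suc n))) (fromℕ-suc (suc n)) ⟩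
  (1ℚ + N₁) * (f 0 * g (suc (suc n)) + (f /t ⊛ g) (suc n))
    ≡⟨ expand N₁ (f 0) (g (suc (suc n))) ((f /t ⊛ g) (suc n)) ⟩
  f 0 * ((1ℚ + N₁) * g (suc (suc n))) + ((f /t ⊛ g) (suc n) + D (f /t ⊛ g) n)
    ≡⟨ cong₂ _+_ (cong (λ x → f 0 * (x * g (suc (suc n)))) (sym (fromℕ-suc (suc n))))
        (cong ((f /t ⊛ g) (suc n) +_) (D-leibniz (f /t) g n)) ⟩
  f 0 * D g (suc n) + (f 1 * g (suc n) + (f /t /t ⊛ g) n + ((D (f /t) ⊛ g) n + (f /t ⊛ D g) n))
    ≡⟨ regroup (f 0 * D g (suc n)) (f 1) (g (suc n))
        ((f /t /t ⊛ g) n) ((D (f /t) ⊛ g) n) ((f /t ⊛ D g) n) ⟩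
  1ℚ * f 1 * g (suc n) + ((f /t /t ⊛ g) n + (D (f /t) ⊛ g) n) + (f 0 * D g (suc n) + (f /t ⊛ D g) n)
    ≡⟨ cong (λ x → 1ℚ * f 1 * g (suc n) + x + (f ⊛ D g) (suc n)) (⊛-distribʳ-⊕ (f /t /t) (D (f /t)) g n) ⟨
  1ℚ * f 1 * g (suc n) + ((f /t /t ⊕ D (f /t)) ⊛ g) n + (f ⊛ D g) (suc n)
    ≡⟨ cong (λ x → 1ℚ * f 1 * g (suc n) + x + (f ⊛ D g) (suc n)) (⊛-congʳ g (D-/t f) n) ⟨
  (D f ⊛ g) (suc n) + (f ⊛ D g) (suc n) ∎
  where
  N₁ = fromℕ (suc n)
  N₂ = fromℕ (suc (suc n))
  expand : ∀ a b c d → (1ℚ + a) * (b * c + d) ≡ b * ((1ℚ + a) * c) + (d + a * d)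
  expand = solve-∀ ring
  regroup : ∀ a b c d e h → a + (b * c + d + (e + h)) ≡ 1ℚ * b * c + (d + e) + (a + h)
  regroup = solve-∀ ring

D-^ˢ : ∀ g j → D (g ^ˢ suc j) ≗ fromℕ (suc j) • (g ^ˢ j ⊛ D g)
D-^ˢ g zero n = begin
  D (g ⊛ 1ˢ) n            ≡⟨ cong (fromℕ (suc n) *_) (trans (⊛-comm g 1ˢ (suc n)) (⊛-identityˡ g (suc n))) ⟩
  D g n                   ≡⟨ ⊛-identityˡ (D g) n ⟨
  (1ˢ ⊛ D g) n            ≡⟨ *-identityˡ _ ⟨
  1ℚ * (1ˢ ⊛ D g) n       ∎
D-^ˢ g (suc j) n = begin
  D (g ⊛ h) n                       ≡⟨ D-leibniz g h n ⟩
  (D g ⊛ h) n + (g ⊛ D h) n         ≡⟨ cong₂ _+_ (⊛-comm (D g) h n) (⊛-congˡ g (D-^ˢ g j) n) ⟩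
  (h ⊛ D g) n + (g ⊛ (J • (g ^ˢ j ⊛ D g))) n ≡⟨ cong ((h ⊛ D g) n +_) (⊛-•ʳ J g (g ^ˢ j ⊛ D g) n) ⟩
  (h ⊛ D g) n + J * (g ⊛ (g ^ˢ j ⊛ D g)) n   ≡⟨ cong (λ x → (h ⊛ D g) n + J * x) (⊛-assoc g (g ^ˢ j) (D g) n) ⟨
  (h ⊛ D g) n + J * (h ⊛ D g) n     ≡⟨ factor J ((h ⊛ D g) n) ⟩
  (1ℚ + J) * (h ⊛ D g) n            ≡⟨ cong (_* (h ⊛ D g) n) (fromℕ-suc (suc j)) ⟨
  fromℕ (suc (suc j)) * (h ⊛ D g) n ∎
  where
  h = g ^ˢ suc j
  J = fromℕ (suc j)
  factor : ∀ a b → b + a * b ≡ (1ℚ + a) * b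
  factor = solve-∀ ring

-- Composition, inverses and quotients of power series.

sum-truncate : ∀ {m n} (a : ℕ → ℚ) → m ≤ n → (∀ j → m < j → a j ≡ 0ℚ) →
               ∑[ j ≤ n ] (a (toℕ j)) ≡ ∑[ j ≤ m ] (a (toℕ j))
sum-truncate {n = n} a z≤n p = cong (a 0 +_)
  (trans (sum-cong-≗ {n} (λ j → p (suc (toℕ j)) (s≤s z≤n))) (sum-replicate-zero n))
sum-truncate a (s≤s m≤n) p = cong (a 0 +_) (sum-truncate (a /t) m≤n (λ j m<j → p (suc j) (s≤s m<j)))

-- As `g 0` vanishes, coefficient n + 1 of `g ⊛ g ^ˢ j` is coefficient n of `g /t ⊛ g ^ˢ j`, which
-- involves `g ^ˢ j` only in degrees up to n.
^ˢ-order : ∀ g → g 0 ≡ 0ℚ → ∀ {n j} → n < j → (g ^ˢ j) n ≡ 0ℚ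
^ˢ-order g g₀ {zero} {suc j} _ = begin
  g 0 * (g ^ˢ j) 0 + 0ℚ ≡⟨ cong (λ x → x * (g ^ˢ j) 0 + 0ℚ) g₀ ⟩
  0ℚ * (g ^ˢ j) 0 + 0ℚ  ≡⟨ cong (_+ 0ℚ) (*-zeroˡ ((g ^ˢ j) 0)) ⟩
  0ℚ                    ∎
^ˢ-order g g₀ {suc n} {suc j} (s≤s n<j) = begin
  g 0 * (g ^ˢ j) (suc n) + (g /t ⊛ g ^ˢ j) n
    ≡⟨ cong₂ (λ x y → x * (g ^ˢ j) (suc n) + y) g₀ vanish ⟩
  0ℚ * (g ^ˢ j) (suc n) + 0ℚ
    ≡⟨ cong (_+ 0ℚ) (*-zeroˡ ((g ^ˢ j) (suc n))) ⟩
  0ℚ ∎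
  where
  vanish : (g /t ⊛ g ^ˢ j) n ≡ 0ℚ
  vanish = trans
    (sum-cong-≗ {suc n} (λ i → trans
      (cong ((g /t) (toℕ i) *_) (^ˢ-order g g₀ (ℕ.≤-<-trans (ℕ.m∸n≤m n (toℕ i)) n<j)))
      (*-zeroʳ ((g /t) (toℕ i)))))
    (sum-replicate-zero (suc n))

-- As g ^ˢ j starts in degree j, the sums defining the coefficients of f ∘ˢ g can
-- all be extended to the same bound n.
∘ˢ-⊛ : ∀ f g h → g 0 ≡ 0ℚ → ∀ n →
       ((f ∘ˢ g) ⊛ h) n ≡ ∑[ j ≤ n ] (f (toℕ j) * (g ^ˢ toℕ j ⊛ h) n)
∘ˢ-⊛ f g h g₀ n = begin
  ∑[ i ≤ n ] ((f ∘ˢ g) (toℕ i) * h (n ∸ toℕ i))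
    ≡⟨ sum-cong-≗ {suc n} (λ i → cong (_* h (n ∸ toℕ i)) (extend (toℕ i) (ℕ.≤-pred (toℕ<n i)))) ⟩
  ∑[ i ≤ n ] (∑[ j ≤ n ] term (toℕ i) (toℕ j) * h (n ∸ toℕ i))
    ≡⟨ sum-cong-≗ {suc n} (λ i → *-distribʳ-sum {suc n} (h (n ∸ toℕ i)) (λ j → term (toℕ i) (toℕ j))) ⟩
  ∑[ i ≤ n ] (∑[ j ≤ n ] (term (toℕ i) (toℕ j) * h (n ∸ toℕ i)))
    ≡⟨ ∑-comm {suc n} {suc n} (λ i j → term (toℕ i) (toℕ j) * h (n ∸ toℕ i)) ⟩
  ∑[ j ≤ n ] (∑[ i ≤ n ] (term (toℕ i) (toℕ j) * h (n ∸ toℕ i)))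
    ≡⟨ sum-cong-≗ {suc n} (λ j → ⊛-•ˡ (f (toℕ j)) (g ^ˢ toℕ j) h n) ⟩
  ∑[ j ≤ n ] (f (toℕ j) * (g ^ˢ toℕ j ⊛ h) n) ∎
  where
  term : ℕ → ℕ → ℚ
  term i j = f j * (g ^ˢ j) i
  extend : ∀ i → i ≤ n → (f ∘ˢ g) i ≡ ∑[ j ≤ n ] term i (toℕ j)
  extend i i≤n = sym (sum-truncate (term i) i≤n
    (λ j i<j → trans (cong (f j *_) (^ˢ-order g g₀ i<j)) (*-zeroʳ (f j))))

-- From f(g) = f 0 + g · (f /t)(g), cancelling t in the last term. This one identity serves both the
-- geometric series behind `_⁻¹` and the quotients by g.
∘ˢ-/t : ∀ f g → g 0 ≡ 0ℚ → (f ∘ˢ g) /t ≗ ((f /t) ∘ˢ g) ⊛ g /t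
∘ˢ-/t f g g₀ n = begin
  -- The term j = 0 contributes `f 0 * 0ℚ`, since `g ^ˢ 0` is `1ˢ` and has no coefficient in
  -- positive degree.
  f 0 * 0ℚ + ∑[ j ≤ n ] (f (suc (toℕ j)) * (g ⊛ g ^ˢ toℕ j) (suc n))
    ≡⟨ cong₂ _+_ (*-zeroʳ (f 0)) (sum-cong-≗ {suc n} (λ j → cong (f (suc (toℕ j)) *_) (power (toℕ j)))) ⟩
  0ℚ + ∑[ j ≤ n ] (f (suc (toℕ j)) * (g ^ˢ toℕ j ⊛ g /t) n)
    ≡⟨ +-identityˡ _ ⟩
  ∑[ j ≤ n ] (f (suc (toℕ j)) * (g ^ˢ toℕ j ⊛ g /t) n)
    ≡⟨ ∘ˢ-⊛ (f /t) g (g /t) g₀ n ⟨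
  (((f /t) ∘ˢ g) ⊛ g /t) n ∎
  where
  power : ∀ j → (g ⊛ g ^ˢ j) (suc n) ≡ (g ^ˢ j ⊛ g /t) n
  power j = begin
    g 0 * (g ^ˢ j) (suc n) + (g /t ⊛ g ^ˢ j) n
      ≡⟨ cong (λ x → x * (g ^ˢ j) (suc n) + (g /t ⊛ g ^ˢ j) n) g₀ ⟩
    0ℚ * (g ^ˢ j) (suc n) + (g /t ⊛ g ^ˢ j) n
      ≡⟨ cong (_+ (g /t ⊛ g ^ˢ j) n) (*-zeroˡ ((g ^ˢ j) (suc n))) ⟩
    0ℚ + (g /t ⊛ g ^ˢ j) n
      ≡⟨ +-identityˡ _ ⟩
    (g /t ⊛ g ^ˢ j) n
      ≡⟨ ⊛-comm (g /t) (g ^ˢ j) n ⟩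
    (g ^ˢ j ⊛ g /t) n ∎

-- Differentiate term by term: the power rule sends the term of index j + 1 of `f` to the term of
-- index j of `D f`, and the term of index 0 is constant.
D-∘ˢ : ∀ f g → g 0 ≡ 0ℚ → D (f ∘ˢ g) ≗ (D f ∘ˢ g) ⊛ D g
D-∘ˢ f g g₀ n = begin
  N * (f 0 * 0ℚ + ∑[ j ≤ n ] (f (suc (toℕ j)) * (g ^ˢ suc (toℕ j)) (suc n)))
    ≡⟨ cong (N *_) (trans (cong (_+ rest) (*-zeroʳ (f 0))) (+-identityˡ rest)) ⟩
  N * rest
    ≡⟨ *-distribˡ-sum {suc n} N (λ j → f (suc (toℕ j)) * (g ^ˢ suc (toℕ j)) (suc n)) ⟩
  ∑[ j ≤ n ] (N * (f (suc (toℕ j)) * (g ^ˢ suc (toℕ j)) (suc n)))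
    ≡⟨ sum-cong-≗ {suc n} (λ j → power (toℕ j)) ⟩
  ∑[ j ≤ n ] (D f (toℕ j) * (g ^ˢ toℕ j ⊛ D g) n)
    ≡⟨ ∘ˢ-⊛ (D f) g (D g) g₀ n ⟨
  ((D f ∘ˢ g) ⊛ D g) n ∎
  where
  N = fromℕ (suc n)
  rest = ∑[ j ≤ n ] (f (suc (toℕ j)) * (g ^ˢ suc (toℕ j)) (suc n))
  power : ∀ j → N * (f (suc j) * (g ^ˢ suc j) (suc n)) ≡ D f j * (g ^ˢ j ⊛ D g) n
  power j = trans (*-swap N (f (suc j)) ((g ^ˢ suc j) (suc n)))
    (trans (cong (f (suc j) *_) (D-^ˢ g j n))
      (*-shift (f (suc j)) (fromℕ (suc j)) ((g ^ˢ j ⊛ D g) n)))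

-- `f ⁻¹` is c G, where G is the geometric series in u = 1 - c f. Shifting gives `G /t` = - c (G ⊛ f
-- /t), and with c · f 0 = 1 this cancels every coefficient of c G f in positive degree.
⁻¹-inverseʳ : ∀ f .{{_ : NonZero (f 0)}} → f ⊛ f ⁻¹ ≗ 1ˢ
⁻¹-inverseʳ f = λ n → trans (⊛-comm f (f ⁻¹) n) (trans (⊛-•ˡ c G f n) (c•G⊛f n))
  where
  c = 1/ f 0
  u : FPS
  u m = 1ˢ m ℚ.- c * f m
  G = (λ _ → 1ℚ) ∘ˢ u
  u₀ : u 0 ≡ 0ℚ
  u₀ = cong (λ x → 1ℚ ℚ.- x) (*-inverseˡ (f 0))
  u/t : u /t ≗ (- c) • f /t
  u/t m = neg c (f (suc m))
    where
    neg : ∀ a b → 0ℚ + - (a * b) ≡ - a * b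
    neg = solve-∀ ring
  c•G⊛f : ∀ n → c * (G ⊛ f) n ≡ 1ˢ n
  c•G⊛f zero    = trans (lemma c (f 0)) (*-inverseˡ (f 0))
    where
    lemma : ∀ a b → a * ((1ℚ * 1ℚ + 0ℚ) * b + 0ℚ) ≡ a * b
    lemma = solve-∀ ring
  c•G⊛f (suc n) = begin
    c * (G ⊛ f) (suc n)
      ≡⟨ cong (c *_) (⊛-shiftʳ G f n) ⟩
    c * (G (suc n) * f 0 + X)
      ≡⟨ cong (λ x → c * (x * f 0 + X)) G-suc ⟩
    c * (- c * X * f 0 + X)
      ≡⟨ regroup c X (f 0) ⟩
    c * (X + - (c * f 0 * X))
      ≡⟨ cong (λ x → c * (X + - (x * X))) (*-inverseˡ (f 0)) ⟩
    c * (X + - (1ℚ * X))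
      ≡⟨ cancel c X ⟩
    0ℚ ∎
    where
    X = (G ⊛ f /t) n
    G-suc : G (suc n) ≡ - c * X
    -- The constant sequence 1 is its own shift, so `∘ˢ-/t` returns `G` itself as a factor.
    G-suc = trans (∘ˢ-/t (λ _ → 1ℚ) u u₀ n)
      (trans (⊛-congˡ G u/t n) (⊛-•ʳ (- c) G (f /t) n))
    regroup : ∀ a b d → a * (- a * b * d + b) ≡ a * (b + - (a * d * b))
    regroup = solve-∀ ring
    cancel : ∀ a b → a * (b + - (1ℚ * b)) ≡ 0ℚ
    cancel = solve-∀ ring

-- By `∘ˢ-/t` the shifted numerator is a multiple of `g /t`, which the inverse cancels. For `Li k`
-- it identifies the poly-Bernoulli series as Li_k(x)/x evaluated at x = 1 - e⁻ᵗ.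
∘ˢ-⊘ : ∀ f g .{{_ : NonZero (g 1)}} → g 0 ≡ 0ℚ → (f ∘ˢ g) ⊘ g ≗ (f /t) ∘ˢ g
∘ˢ-⊘ f g g₀ n = begin
  ((f ∘ˢ g) /t ⊛ (g /t) ⁻¹) n       ≡⟨ ⊛-congʳ ((g /t) ⁻¹) (∘ˢ-/t f g g₀) n ⟩
  ((P ⊛ g /t) ⊛ (g /t) ⁻¹) n        ≡⟨ ⊛-assoc P (g /t) ((g /t) ⁻¹) n ⟩
  (P ⊛ (g /t ⊛ (g /t) ⁻¹)) n        ≡⟨ ⊛-congˡ P (⁻¹-inverseʳ (g /t)) n ⟩
  (P ⊛ 1ˢ) n                        ≡⟨ ⊛-comm P 1ˢ n ⟩
  (1ˢ ⊛ P) n                        ≡⟨ ⊛-identityˡ P n ⟩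
  P n                               ∎
  where
  P = (f /t) ∘ˢ g

∘ˢ-congˡ : ∀ {f f′} g → f ≗ f′ → f ∘ˢ g ≗ f′ ∘ˢ g
∘ˢ-congˡ g p n = sum-cong-≗ {suc n} (λ j → cong (_* (g ^ˢ toℕ j) n) (p (toℕ j)))

-- Derivatives of the polylogarithm and of its composite with 1 - e⁻ᵗ.

D-Li : ∀ k → D (Li k) ≗ Li (k - 1ℤ) /t
-- Here the index passes from the reciprocal branch of `Li` to the power branch: the factor n + 1 is
-- matched with its first power.
D-Li (ℤ.+ zero) n = trans (*-identityʳ (fromℕ (suc n))) (cong fromℕ (sym (ℕ.*-identityʳ (suc n))))
-- Both sides are inverse to the m-th power of n + 1.
D-Li (ℤ.+ suc m) n = inverse-unique {fromℕ (suc n ℕ.^ m)}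
  (begin
    fromℕ (suc n ℕ.^ m) * (fromℕ (suc n) * Li (ℤ.+ suc m) (suc n))
      ≡⟨ *-shift (fromℕ (suc n ℕ.^ m)) (fromℕ (suc n)) (Li (ℤ.+ suc m) (suc n)) ⟩
    fromℕ (suc n) * fromℕ (suc n ℕ.^ m) * Li (ℤ.+ suc m) (suc n)
      ≡⟨ cong (_* Li (ℤ.+ suc m) (suc n)) (fromℕ-* (suc n) (suc n ℕ.^ m)) ⟨
    fromℕ (suc n ℕ.^ suc m) * Li (ℤ.+ suc m) (suc n)
      ≡⟨ fromℕ-inverseʳ (suc n ℕ.^ suc m) {{ℕ.m^n≢0 (suc n) (suc m)}} ⟩
    1ℚ ∎)
  (fromℕ-inverseʳ (suc n ℕ.^ m) {{ℕ.m^n≢0 (suc n) m}})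
D-Li -[1+ m ] n = trans (sym (fromℕ-* (suc n) (suc n ℕ.^ suc m)))
  -- `-[1+ m ] - 1ℤ` computes to `-[1+ suc (m ℕ.+ 0) ]`, hence the correction of the exponent.
  (cong (λ i → fromℕ (suc n ℕ.^ suc (suc i))) (sym (ℕ.+-identityʳ m)))

oneMinusExp⁻ : FPS
oneMinusExp⁻ = 1ˢ ⊖ exp⁻

-- The minus sign in front of e⁻ᵗ absorbs one factor -1. This is why `mixed-sum` carries the sign of
-- exponent n - m although the coefficient used has degree n + 1 - m.
oneMinusExp⁻-suc : ∀ n → oneMinusExp⁻ (suc n) ≡ sgn n * exp (suc n)
oneMinusExp⁻-suc n = neg (sgn n) (exp (suc n))
  where
  neg : ∀ a b → 0ℚ + - (- 1ℚ * a * b) ≡ a * b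
  neg = solve-∀ ring

D-oneMinusExp⁻ : D oneMinusExp⁻ ≗ exp⁻
D-oneMinusExp⁻ n = begin
  fromℕ (suc n) * oneMinusExp⁻ (suc n)     ≡⟨ cong (fromℕ (suc n) *_) (oneMinusExp⁻-suc n) ⟩
  fromℕ (suc n) * (sgn n * exp (suc n))   ≡⟨ *-swap (fromℕ (suc n)) (sgn n) (exp (suc n)) ⟩
  sgn n * (fromℕ (suc n) * exp (suc n))   ≡⟨ cong (sgn n *_) (suc-exp n) ⟩
  sgn n * exp n                           ∎

liSeries : ℤ → FPS
liSeries k = Li k ∘ˢ oneMinusExp⁻

-- Multiplies the quotient back: both sides are `(Li k /t) ∘ˢ oneMinusExp⁻` times `oneMinusExp⁻ /t`.
polyBernoulliSeries-⊛ : ∀ k → polyBernoulliSeries k ⊛ oneMinusExp⁻ /t ≗ liSeries k /t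
polyBernoulliSeries-⊛ k n = trans
  (⊛-congʳ (oneMinusExp⁻ /t) (∘ˢ-⊘ (Li k) oneMinusExp⁻ refl) n)
  (sym (∘ˢ-/t (Li k) oneMinusExp⁻ refl n))

D-liSeries : ∀ k → D (liSeries k) ≗ polyBernoulliSeries (k - 1ℤ) ⊛ exp⁻
D-liSeries k n = begin
  D (liSeries k) n
    ≡⟨ D-∘ˢ (Li k) oneMinusExp⁻ refl n ⟩
  ((D (Li k) ∘ˢ oneMinusExp⁻) ⊛ D oneMinusExp⁻) n
    ≡⟨ ⊛-cong (∘ˢ-congˡ oneMinusExp⁻ (D-Li k)) D-oneMinusExp⁻ n ⟩
  ((Li (k - 1ℤ) /t ∘ˢ oneMinusExp⁻) ⊛ exp⁻) n
    ≡⟨ ⊛-congʳ exp⁻ (∘ˢ-⊘ (Li (k - 1ℤ)) oneMinusExp⁻ refl) n ⟨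
  (polyBernoulliSeries (k - 1ℤ) ⊛ exp⁻) n ∎

-- Both sides of the identity as one coefficient of a product.

mixed-sum : ∀ n r k →
    ∑[ m ≤ n ] (binom (suc n) (toℕ m) * sgn (n ∸ toℕ m) * mixed r k (toℕ m))
    ≡ fromℕ (suc n !) * (bernoulliSeries r ⊛ liSeries k /t) n
mixed-sum n r k = begin
  ∑[ m ≤ n ] (binom (suc n) (toℕ m) * sgn (n ∸ toℕ m) * mixed r k (toℕ m))
    -- The summand pairs degree m of `S` with degree n + 1 - m of 1 - e⁻ᵗ. The range stops at m = n
    -- because 1 - e⁻ᵗ has no constant term, so the sum is a Cauchy product with `oneMinusExp⁻ /t`.
    ≡⟨ sum-cong-≗ {suc n} (λ m → term (toℕ m) (ℕ.≤-pred (toℕ<n m))) ⟩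
  ∑[ m ≤ n ] (N! * (S (toℕ m) * oneMinusExp⁻ (suc (n ∸ toℕ m))))
    ≡⟨ *-distribˡ-sum {suc n} N! (λ m → S (toℕ m) * oneMinusExp⁻ (suc (n ∸ toℕ m))) ⟨
  N! * (S ⊛ oneMinusExp⁻ /t) n
    ≡⟨ cong (N! *_) (⊛-assoc (bernoulliSeries r) (polyBernoulliSeries k) (oneMinusExp⁻ /t) n) ⟩
  N! * (bernoulliSeries r ⊛ (polyBernoulliSeries k ⊛ oneMinusExp⁻ /t)) n
    ≡⟨ cong (N! *_) (⊛-congˡ (bernoulliSeries r) (polyBernoulliSeries-⊛ k) n) ⟩
  N! * (bernoulliSeries r ⊛ liSeries k /t) n ∎
  where
  N! = fromℕ (suc n !)
  S = bernoulliSeries r ⊛ polyBernoulliSeries k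
  shuffle : ∀ b s m x → b * s * (m * x) ≡ b * m * (x * s)
  shuffle = solve-∀ ring
  shuffle′ : ∀ a e x s → a * e * (x * s) ≡ a * (x * (s * e))
  shuffle′ = solve-∀ ring
  term : ∀ m → m ≤ n → binom (suc n) m * sgn (n ∸ m) * mixed r k m
                       ≡ N! * (S m * oneMinusExp⁻ (suc (n ∸ m)))
  term m m≤n = begin
    binom (suc n) m * sgn (n ∸ m) * (fromℕ (m !) * S m)
      ≡⟨ shuffle (binom (suc n) m) (sgn (n ∸ m)) (fromℕ (m !)) (S m) ⟩
    binom (suc n) m * fromℕ (m !) * (S m * sgn (n ∸ m))
      ≡⟨ cong (_* (S m * sgn (n ∸ m))) (binom-! (ℕ.m≤n⇒m≤1+n m≤n)) ⟩
    N! * exp (suc n ∸ m) * (S m * sgn (n ∸ m))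
      ≡⟨ cong (λ i → N! * exp i * (S m * sgn (n ∸ m))) (ℕ.+-∸-assoc 1 m≤n) ⟩
    N! * exp (suc (n ∸ m)) * (S m * sgn (n ∸ m))
      ≡⟨ shuffle′ N! (exp (suc (n ∸ m))) (S m) (sgn (n ∸ m)) ⟩
    N! * (S m * (sgn (n ∸ m) * exp (suc (n ∸ m))))
      ≡⟨ cong (λ x → N! * (S m * x)) (oneMinusExp⁻-suc (n ∸ m)) ⟨
    N! * (S m * oneMinusExp⁻ (suc (n ∸ m))) ∎

-- Joins l + 1 and `l !` into the factorial of l + 1, then applies `binom-!`. On the right-hand side
-- of the identity, `(n ∸ l) !` comes from `bernoulli`, `l !` from the inner binomial and l + 1 from
-- differentiating.
binom-suc-! : ∀ {n l} → l ≤ n →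
  binom (suc n) (suc l) * fromℕ ((n ∸ l) !) * fromℕ (l !) * fromℕ (suc l) ≡ fromℕ (suc n !)
binom-suc-! {n} {l} l≤n = begin
  B * D′ * L * M       ≡⟨ shuffle B D′ L M ⟩
  B * (M * L) * D′     ≡⟨ cong (λ x → B * x * D′) (fromℕ-* (suc l) (l !)) ⟨
  B * fromℕ (suc l !) * D′ ≡⟨ cong (_* D′) (binom-! (s≤s l≤n)) ⟩
  fromℕ (suc n !) * exp (n ∸ l) * D′ ≡⟨ assoc (fromℕ (suc n !)) (exp (n ∸ l)) D′ ⟩
  fromℕ (suc n !) * (D′ * exp (n ∸ l)) ≡⟨ cong (fromℕ (suc n !) *_) (!-exp (n ∸ l)) ⟩
  fromℕ (suc n !) * 1ℚ ≡⟨ *-identityʳ _ ⟩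
  fromℕ (suc n !) ∎
  where
  B = binom (suc n) (suc l)
  D′ = fromℕ ((n ∸ l) !)
  L = fromℕ (l !)
  M = fromℕ (suc l)
  shuffle : ∀ b d l m → b * d * l * m ≡ b * (m * l) * d
  shuffle = solve-∀ ring
  assoc : ∀ a b c → a * b * c ≡ a * (c * b)
  assoc = solve-∀ ring

-- For fixed l the sum over m is, up to factors free of m, the Cauchy product of the poly-Bernoulli
-- series of index k - 1 with `exp⁻` in degree l. By `D-liSeries` that is l + 1 times coefficient l
-- + 1 of `liSeries k`, and the sum over l multiplies by `bernoulliSeries r`.
polyBernoulli-bernoulli-sum : ∀ n r k →
    ∑[ l ≤ n ] (∑[ m ≤ toℕ l ]
        (sgn (toℕ l ∸ toℕ m) * binom (toℕ l) (toℕ m) * binom (suc n) (suc (toℕ l))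
          * polyBernoulli (k - 1ℤ) (toℕ m) * bernoulli r (n ∸ toℕ l)))
    ≡ fromℕ (suc n !) * (bernoulliSeries r ⊛ liSeries k /t) n
polyBernoulli-bernoulli-sum n r k = begin
  ∑[ l ≤ n ] (∑[ m ≤ toℕ l ] summand (toℕ l) (toℕ m))
    ≡⟨ sum-cong-≗ {suc n} (λ l → term (toℕ l) (ℕ.≤-pred (toℕ<n l))) ⟩
  ∑[ l ≤ n ] (N! * (liSeries k (suc (toℕ l)) * F (n ∸ toℕ l)))
    ≡⟨ *-distribˡ-sum {suc n} N! (λ l → liSeries k (suc (toℕ l)) * F (n ∸ toℕ l)) ⟨
  N! * (liSeries k /t ⊛ F) n
    ≡⟨ cong (N! *_) (⊛-comm (liSeries k /t) F n) ⟩
  N! * (F ⊛ liSeries k /t) n ∎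
  where
  N! = fromℕ (suc n !)
  F = bernoulliSeries r
  P = polyBernoulliSeries (k - 1ℤ)
  summand : ℕ → ℕ → ℚ
  summand l m = sgn (l ∸ m) * binom l m * binom (suc n) (suc l)
                  * (fromℕ (m !) * P m) * (fromℕ ((n ∸ l) !) * F (n ∸ l))
  shuffle : ∀ s b c m p d f → s * b * c * (m * p) * (d * f) ≡ (c * d * f) * (p * (s * (b * m)))
  shuffle = solve-∀ ring
  shuffle′ : ∀ c d f p s l e → (c * d * f) * (p * (s * (l * e))) ≡ (c * d * l * f) * (p * (s * e))
  shuffle′ = solve-∀ ring
  regroup : ∀ a b c d → a * b * (c * d) ≡ a * c * (d * b)
  regroup = solve-∀ ring
  term : ∀ l → l ≤ n → ∑[ m ≤ l ] summand l (toℕ m) ≡ N! * (liSeries k (suc l) * F (n ∸ l))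
  term l l≤n = begin
    ∑[ m ≤ l ] summand l (toℕ m)
      ≡⟨ sum-cong-≗ {suc l} (λ m → inner (toℕ m) (ℕ.≤-pred (toℕ<n m))) ⟩
    ∑[ m ≤ l ] (Q * F (n ∸ l) * (P (toℕ m) * exp⁻ (l ∸ toℕ m)))
      ≡⟨ *-distribˡ-sum {suc l} (Q * F (n ∸ l)) (λ m → P (toℕ m) * exp⁻ (l ∸ toℕ m)) ⟨
    Q * F (n ∸ l) * (P ⊛ exp⁻) l
      ≡⟨ cong ((Q * F (n ∸ l)) *_) (D-liSeries k l) ⟨
    Q * F (n ∸ l) * (fromℕ (suc l) * liSeries k (suc l))
      ≡⟨ regroup Q (F (n ∸ l)) (fromℕ (suc l)) (liSeries k (suc l)) ⟩
    Q * fromℕ (suc l) * (liSeries k (suc l) * F (n ∸ l))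
      ≡⟨ cong (_* (liSeries k (suc l) * F (n ∸ l))) (binom-suc-! l≤n) ⟩
    N! * (liSeries k (suc l) * F (n ∸ l)) ∎
    where
    B = binom (suc n) (suc l)
    E = fromℕ ((n ∸ l) !)
    Q = B * E * fromℕ (l !)
    inner : ∀ m → m ≤ l → summand l m ≡ Q * F (n ∸ l) * (P m * exp⁻ (l ∸ m))
    inner m m≤l = begin
      summand l m
        ≡⟨ shuffle (sgn (l ∸ m)) (binom l m) B (fromℕ (m !)) (P m) E (F (n ∸ l)) ⟩
      B * E * F (n ∸ l) * (P m * (sgn (l ∸ m) * (binom l m * fromℕ (m !))))
        ≡⟨ cong (λ x → B * E * F (n ∸ l) * (P m * (sgn (l ∸ m) * x))) (binom-! m≤l) ⟩
      B * E * F (n ∸ l) * (P m * (sgn (l ∸ m) * (fromℕ (l !) * exp (l ∸ m))))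
        ≡⟨ shuffle′ B E (F (n ∸ l)) (P m) (sgn (l ∸ m)) (fromℕ (l !)) (exp (l ∸ m)) ⟩
      Q * F (n ∸ l) * (P m * exp⁻ (l ∸ m)) ∎

theorem5 : (n : ℕ) (r k : ℤ) →
    ∑[ m ≤ n ] (binom (suc n) (toℕ m) * sgn (n ∸ toℕ m) * mixed r k (toℕ m))
    ≡ ∑[ l ≤ n ] (∑[ m ≤ toℕ l ]
        (sgn (toℕ l ∸ toℕ m) * binom (toℕ l) (toℕ m) * binom (suc n) (suc (toℕ l))
          * polyBernoulli (k - 1ℤ) (toℕ m) * bernoulli r (n ∸ toℕ l)))
theorem5 n r k = trans (mixed-sum n r k) (sym (polyBernoulli-bernoulli-sum n r k))
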